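{- Let $G$ be a finite group, $H$ a subgroup, and $S\subseteq G\setminus H$ a set of representatives of pairwise distinct double cosets $HsH$ with $\langle H,S\rangle=G$, and suppose $\mathcal{G}=\mathcal{G}(G,H,S)$ is not complete. Let $R_1,R_2$ be a partition of $S$ such that the group $G'=\langle H,R_1\rangle$ contains no element of $R_2$, and let $\mathcal{G}'=\mathcal{G}(G',H,R_1)$. Suppose that whenever $r,s\in R_2$ satisfy $G'rG'=G'sG'$, we have $\langle H,r\rangle=\langle H,s\rangle$. Then $$\kappa(\mathcal{G})\geq\min\big(|V(\mathcal{G}')|,\ \kappa(\mathcal{G}')+d_{R_2}\big).$$
   Context: The Cayley coset digraph $\mathcal{G}(K,H,T)$ (for a group $K$, subgroup $H$, $T\subseteq K\setminus H$) has vertex set $K/H$ of left cosets of $H$ in $K$, and $(gH,g'H)$ is an edge iff $gHt\cap g'H\neq\emptyset$ for some $t\in T$. For $s\in S$, $d_s=|HsH/H|$ is the number of left cosets of $H$ contained in $HsH$, and $d_{R}=\sum_{s\in R}d_s$. $\kappa(\Gamma)$ denotes the vertex connectivity: the smallest number of vertices whose removal leaves a digraph that is not strongly connected (for a complete digraph on $m$ vertices it is $m-1$). A digraph is complete if every ordered pair of distinct vertices is an edge. -}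

module Defs where

open import Data.Nat using (ℕ; zero; suc; _+_; _*_; _≤_; NonZero)
open import Data.Nat.DivMod using (_/_)
open import Data.Fin using (Fin)
open import Data.Fin.Properties using (any?; _≟_)
open import Data.Fin.Subset using (Subset; _∈_; _∉_; _⊆_; ∣_∣)
open import Data.Fin.Subset.Properties using (_∈?_)
open import Data.Vec using (tabulate)
open import Data.List using (map; allFin)
open import Data.Nat.ListAction using (sum)
open import Data.Product using (Σ; ∃; _×_; _,_)
open import Data.Sum using (_⊎_)
open import Data.Bool using (if_then_else_)
open import Relation.Nullary using (¬_; does)
open import Relation.Nullary.Decidable using (_×-dec_)
open import Relation.Binary.PropositionalEquality using (_≡_)
open import Algebra.Structures using (IsGroup)

-- A finite group: carrier Fin n (every finite group is isomorphic to such a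
-- group), with propositional equality.
record FiniteGroup : Set where
  field
    n       : ℕ
    _∙_     : Fin n → Fin n → Fin n
    ε       : Fin n
    _⁻¹     : Fin n → Fin n
    isGroup : IsGroup _≡_ _∙_ ε _⁻¹

Sub : FiniteGroup → Set
Sub G = Subset (FiniteGroup.n G)

module _ (G : FiniteGroup) where
  open FiniteGroup G

  IsSubgroup : Subset n → Set
  IsSubgroup K = (ε ∈ K)
               × (∀ x y → x ∈ K → y ∈ K → (x ∙ y) ∈ K)
               × (∀ x → x ∈ K → (x ⁻¹) ∈ K)

  Generated : Subset n → Fin n → Set
  Generated A x = ∀ (K : Subset n) → IsSubgroup K → A ⊆ K → x ∈ K

  DoubleCoset : Subset n → Fin n → Subset n → Subset n
  DoubleCoset A s B = tabulate λ x →
    does (any? λ a → any? λ b → (a ∈? A) ×-dec ((b ∈? B) ×-dec (x ≟ ((a ∙ s) ∙ b))))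

  -- d_s = |HsH / H| = |HsH| / |H|
  d : (H : Subset n) → ⦃ _ : NonZero ∣ H ∣ ⦄ → Fin n → ℕ
  d H s = ∣ DoubleCoset H s H ∣ / ∣ H ∣

  dSum : (H : Subset n) → ⦃ _ : NonZero ∣ H ∣ ⦄ → Subset n → ℕ
  dSum H R = sum (map (λ s → if does (s ∈? R) then d H s else 0) (allFin n))

  -- Cayley coset digraph 𝒢(K,H,T).  A vertex gH (g ∈ K) is represented by
  -- any element g of its coset; a set of vertices is represented by the
  -- union X ⊆ K of its cosets (an H-saturated subset), so it contains
  -- |X| / |H| vertices.

  SameCoset : Subset n → Fin n → Fin n → Set
  SameCoset H g g' = ((g ⁻¹) ∙ g') ∈ H

  Edge : (H T : Subset n) → Fin n → Fin n → Set
  Edge H T g g' = Σ (Fin n) λ h → Σ (Fin n) λ h' → Σ (Fin n) λ t →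
    h ∈ H × h' ∈ H × t ∈ T × ((g ∙ h) ∙ t ≡ g' ∙ h')

  Saturated : (K H X : Subset n) → Set
  Saturated K H X = X ⊆ K × (∀ x h → x ∈ X → h ∈ H → (x ∙ h) ∈ X)

  data Path (K H T X : Subset n) : Fin n → Fin n → Set where
    here : ∀ {g g'} → SameCoset H g g' → Path K H T X g g'
    step : ∀ {g g'' g'} → Edge H T g g'' → g'' ∈ K → g'' ∉ X →
           Path K H T X g'' g' → Path K H T X g g'

  StronglyConnectedAfter : (K H T X : Subset n) → Set
  StronglyConnectedAfter K H T X = ∀ g g' → g ∈ K → g ∉ X → g' ∈ K → g' ∉ X →
    Path K H T X g g'

  Complete : (K H T : Subset n) → Set
  Complete K H T = ∀ g g' → g ∈ K → g' ∈ K → ¬ SameCoset H g g' → Edge H T g g'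

  -- κ(𝒢(K,H,T)) = k : if complete, k = |V| - 1 (|V| = |K|/|H|); otherwise k is
  -- the minimum number of vertices whose removal leaves a digraph that is not
  -- strongly connected.
  IsVertexConnectivity : (K H T : Subset n) → ℕ → Set
  IsVertexConnectivity K H T k =
      (Complete K H T × (suc k * ∣ H ∣ ≡ ∣ K ∣))
    ⊎ ( ¬ Complete K H T
      × (Σ (Subset n) λ X → Saturated K H X × (k * ∣ H ∣ ≡ ∣ X ∣)
                           × ¬ StronglyConnectedAfter K H T X)
      × (∀ X → Saturated K H X → ¬ StronglyConnectedAfter K H T X →
               k * ∣ H ∣ ≤ ∣ X ∣))

{-# OPTIONS --safe #-}

-- Write δ(A) for the number of out-neighbours of A outside A. Among the sets that
-- violate the bound, for the digraph or its reverse, take one containing the identity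
-- with δ(A), and then |A|, least. By submodularity of δ (the atom argument of Mader,
-- Watkins and Hamidoune) A is contained in each of its translates a⁻¹A with a ∈ A, so
-- it is a subgroup K, and K ⊇ H.
-- If G' ⊆ K, some coset Kr with r ∈ S lies outside K, so δ(K) ≥ |K| ≥ |G'|. Otherwise
-- pick w ∈ HR₁H ∖ K. If K ∩ G' is a fragment of the smaller digraph, its boundary there
-- contributes κ', and HR₂H embeds into the part of the boundary outside G' by x ↦ xw
-- for x ∈ K and x ↦ x for x ∉ K: if xw = y with x ∈ K and y ∉ K, then G'xG' = G'yG',
-- so K contains both x and y. If K ∩ G' dominates G', then δ(K) ≥ |G'|, because a
-- translate of K ∩ G' embeds into the boundary outside G'.
module Submission where

open import Defs
open import Data.Nat using (ℕ; _+_; _≤_; _⊓_; NonZero)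
open import Data.Nat.DivMod using (_/_)
open import Data.Fin.Subset using (Subset; _∈_; _∉_; ∣_∣; _∪_; _∩_; ⊤; ⊥; ⁅_⁆)
open import Data.Product using (_×_)
open import Relation.Nullary using (¬_)
open import Relation.Binary.PropositionalEquality using (_≡_; _≢_)

open import Algebra.Bundles using (Group)
import Algebra.Properties.Group as GroupProperties
open import Data.Bool using (if_then_else_)
open import Data.Empty using (⊥-elim)
open import Data.Fin using (Fin; zero; suc)
open import Data.Fin.Properties using (any?; _≟_; suc-injective)
open import Data.Fin.Subset using (inside; outside; _⊆_; ∁; _-_)
open import Data.Fin.Subset.Properties
open import Data.List using ([]; _∷_; map; allFin)
open import Data.List.Relation.Unary.All as All using (All)
open import Data.List.Relation.Unary.AllPairs as AllPairs using (AllPairs)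
open import Data.List.Relation.Unary.Unique.Propositional.Properties using (allFin⁺)
open import Data.Nat using (zero; suc; _*_; _∸_; _<_; z≤n; s≤s; _≤?_)
open import Data.Nat.DivMod using (m/n*n≤m; m*n/n≡m; /-monoˡ-≤)
open import Data.Nat.Induction using (<-wellFounded)
open import Data.Nat.ListAction using (sum)
open import Data.Nat.Properties hiding (_≟_; suc-injective)
open import Data.Nat.Tactic.RingSolver using (solve-∀)
open import Data.Product using (∃; _,_; proj₁; proj₂)
open import Data.Product.Relation.Binary.Lex.Strict using (×-Lex; ×-wellFounded)
open import Data.Sum using (_⊎_; inj₁; inj₂)
open import Data.Vec using ([]; _∷_; here; there; tabulate)
open import Data.Vec.Properties using (lookup∘tabulate; []=⇒lookup; lookup⇒[]=)
open import Function using (_∘_; _∘′_)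
open import Induction.WellFounded using (Acc; acc)
open import Relation.Binary.PropositionalEquality using (refl; sym; trans; cong; subst)
open import Relation.Nullary using (Dec; yes; no; does)
open import Relation.Nullary.Decidable using (_×-dec_; ¬?; dec-true; decidable-stable)

-- Finite subsets, injections and counting.

module _ {n : ℕ} {P : Fin n → Set} (P? : ∀ x → Dec (P x)) where

  ⟪_⟫ : Subset n
  ⟪_⟫ = tabulate λ x → does (P? x)

  ∈⟪⟫⁺ : ∀ {x} → P x → x ∈ ⟪_⟫
  ∈⟪⟫⁺ {x} px = lookup⇒[]= x _ (trans (lookup∘tabulate _ x) (dec-true (P? x) px))

  ∈⟪⟫⁻ : ∀ {x} → x ∈ ⟪_⟫ → P x
  ∈⟪⟫⁻ {x} x∈ with P? x | trans (sym (lookup∘tabulate (λ y → does (P? y)) x)) ([]=⇒lookup x∈)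
  ... | yes px | _ = px
  ... | no _   | ()

∩⁺ : ∀ {n x} {p q : Subset n} → x ∈ p → x ∈ q → x ∈ p ∩ q
∩⁺ x∈p x∈q = x∈p∩q⁺ (x∈p , x∈q)

∩∁⁺ : ∀ {n x} {p q : Subset n} → x ∈ p → x ∉ q → x ∈ p ∩ ∁ q
∩∁⁺ x∈p x∉q = ∩⁺ x∈p (x∉p⇒x∈∁p x∉q)

∩∁⁻ : ∀ {n x} (p q : Subset n) → x ∈ p ∩ ∁ q → x ∈ p × x ∉ q
∩∁⁻ p q x∈ with x∈p∩q⁻ p (∁ q) x∈
... | x∈p , x∈∁q = x∈p , x∈∁p⇒x∉p x∈∁q

∣∪∣+∣∩∣ : ∀ {n} (p q : Subset n) → ∣ p ∪ q ∣ + ∣ p ∩ q ∣ ≡ ∣ p ∣ + ∣ q ∣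
∣∪∣+∣∩∣ [] [] = refl
∣∪∣+∣∩∣ (outside ∷ p) (outside ∷ q) = ∣∪∣+∣∩∣ p q
∣∪∣+∣∩∣ (outside ∷ p) (inside ∷ q) = trans (cong suc (∣∪∣+∣∩∣ p q)) (sym (+-suc ∣ p ∣ ∣ q ∣))
∣∪∣+∣∩∣ (inside ∷ p) (outside ∷ q) = cong suc (∣∪∣+∣∩∣ p q)
∣∪∣+∣∩∣ (inside ∷ p) (inside ∷ q) = cong suc (trans (+-suc ∣ p ∪ q ∣ ∣ p ∩ q ∣)
  (trans (cong suc (∣∪∣+∣∩∣ p q)) (sym (+-suc ∣ p ∣ ∣ q ∣))))

∣∩∣+∣∩∁∣ : ∀ {n} (p q : Subset n) → ∣ p ∩ q ∣ + ∣ p ∩ ∁ q ∣ ≡ ∣ p ∣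
∣∩∣+∣∩∁∣ [] [] = refl
∣∩∣+∣∩∁∣ (outside ∷ p) (outside ∷ q) = ∣∩∣+∣∩∁∣ p q
∣∩∣+∣∩∁∣ (outside ∷ p) (inside ∷ q) = ∣∩∣+∣∩∁∣ p q
∣∩∣+∣∩∁∣ (inside ∷ p) (outside ∷ q) = trans (+-suc _ _) (cong suc (∣∩∣+∣∩∁∣ p q))
∣∩∣+∣∩∁∣ (inside ∷ p) (inside ∷ q) = cong suc (∣∩∣+∣∩∁∣ p q)

∣p∣+∣∁p∣≡n : ∀ {n} (p : Subset n) → ∣ p ∣ + ∣ ∁ p ∣ ≡ n
∣p∣+∣∁p∣≡n p = trans (cong (∣ p ∣ +_) (∣∁p∣≡n∸∣p∣ p)) (m+[n∸m]≡n (∣p∣≤n p))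

disjoint-card : ∀ {n} (p q y : Subset n) → p ⊆ y → q ⊆ y → (∀ {x} → x ∈ p → x ∉ q) →
  ∣ p ∣ + ∣ q ∣ ≤ ∣ y ∣
disjoint-card p q y p⊆y q⊆y disj = begin
  ∣ p ∣ + ∣ q ∣               ≤⟨ +-mono-≤ (p⊆q⇒∣p∣≤∣q∣ (λ x∈p → ∩⁺ (p⊆y x∈p) x∈p))
                                          (p⊆q⇒∣p∣≤∣q∣ (λ x∈q → ∩∁⁺ (q⊆y x∈q) (λ x∈p → disj x∈p x∈q))) ⟩
  ∣ y ∩ p ∣ + ∣ y ∩ ∁ p ∣     ≡⟨ ∣∩∣+∣∩∁∣ y p ⟩
  ∣ y ∣                       ∎
  where open ≤-Reasoning

⊆∧≥⇒⊇ : ∀ {n} {p q : Subset n} → p ⊆ q → ∣ q ∣ ≤ ∣ p ∣ → q ⊆ p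
⊆∧≥⇒⊇ {p = p} p⊆q ∣q∣≤∣p∣ {x} x∈q with x ∈? p
... | yes x∈p = x∈p
... | no  x∉p = ⊥-elim (<⇒≱ (p⊂q⇒∣p∣<∣q∣ (p⊆q , x , x∈q , x∉p)) ∣q∣≤∣p∣)

-- Induction on `p`, with the value `f zero` removed from the target at each step. Injectivity is
-- asked only on `p`, since maps such as `move` are controlled only on the set being counted.
injection-card : ∀ {m n} (p : Subset m) (q : Subset n) (f : Fin m → Fin n) →
  (∀ {x} → x ∈ p → f x ∈ q) →
  (∀ {x y} → x ∈ p → y ∈ p → f x ≡ f y → x ≡ y) → ∣ p ∣ ≤ ∣ q ∣
injection-card [] q f maps inj = z≤n
injection-card (outside ∷ p) q f maps inj = injection-card p q (f ∘ suc) (maps ∘ there)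
  (λ x∈p y∈p eq → suc-injective (inj (there x∈p) (there y∈p) eq))
injection-card (inside ∷ p) q f maps inj = ≤-trans
  (s≤s (injection-card p (q - f zero) (f ∘ suc)
    (λ x∈p → x∈p∧x≢y⇒x∈p-y (maps (there x∈p)) (λ eq → suc≢zero (inj (there x∈p) here eq)))
    (λ x∈p y∈p eq → suc-injective (inj (there x∈p) (there y∈p) eq))))
  (x∈p⇒∣p-x∣<∣p∣ (maps here))
  where
  suc≢zero : ∀ {m} {i : Fin m} → suc i ≢ zero
  suc≢zero ()

-- The factor `c` will be the order of `H`: the weights count cosets, while sets are counted by
-- elements.
sum-disjoint : ∀ {A : Set} {n} (F : A → Subset n) (w : A → ℕ) (c : ℕ) →
  (∀ s → w s * c ≤ ∣ F s ∣) →
  ∀ {xs} → AllPairs (λ s t → ∀ {x} → x ∈ F s → x ∉ F t) xs →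
  ∀ Y → All (λ s → F s ⊆ Y) xs → sum (map w xs) * c ≤ ∣ Y ∣
sum-disjoint F w c w≤ AllPairs.[] Y All.[] = z≤n
sum-disjoint F w c w≤ {s ∷ xs} (disj AllPairs.∷ disjs) Y (Fs⊆Y All.∷ F⊆Y) = begin
  (w s + sum (map w xs)) * c        ≡⟨ *-distribʳ-+ c (w s) _ ⟩
  w s * c + sum (map w xs) * c      ≤⟨ +-mono-≤ (w≤ s) (sum-disjoint F w c w≤ disjs (Y ∩ ∁ (F s))
                                         (All.zipWith (λ { (d , Ft⊆Y) x∈ → ∩∁⁺ (Ft⊆Y x∈) (λ x∈Fs → d x∈Fs x∈) }) (disj , F⊆Y))) ⟩
  ∣ F s ∣ + ∣ Y ∩ ∁ (F s) ∣         ≤⟨ disjoint-card (F s) (Y ∩ ∁ (F s)) Y Fs⊆Y (λ x∈ → proj₁ (∩∁⁻ Y (F s) x∈))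
                                         (λ x∈Fs x∈ → proj₂ (∩∁⁻ Y (F s) x∈) x∈Fs) ⟩
  ∣ Y ∣                             ∎
  where open ≤-Reasoning

-- Finitely many double negations can be opened one after another. With `¬¬-Dec` this makes
-- reachability decidable while a contradiction is being derived.
¬¬-∀ : ∀ {m} {Q : Fin m → Set} → (∀ x → ¬ ¬ Q x) → ¬ ¬ (∀ x → Q x)
¬¬-∀ {zero}  h k = k (λ ())
¬¬-∀ {suc m} h k = h zero λ q₀ → ¬¬-∀ (h ∘ suc) λ q → k λ { zero → q₀ ; (suc x) → q x }

¬¬-Dec : {A : Set} → ¬ ¬ Dec A
¬¬-Dec k = k (no (k ∘ yes))

-- Excesses |AE| - |A| are compared additively; true differences occur only in the measure `size` of
-- the well-founded recursion, and this lemma passes to them.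
∸-from-+-≤ : ∀ {a b x y} → b ≤ x → a ≤ y → x + a ≤ y + b → x ∸ b ≤ y ∸ a
∸-from-+-≤ {a} {b} {x} {y} b≤x a≤y x+a≤y+b = +-cancelʳ-≤ (b + a) _ _ (begin
  (x ∸ b) + (b + a)     ≡⟨ sym (+-assoc (x ∸ b) b a) ⟩
  ((x ∸ b) + b) + a     ≡⟨ cong (_+ a) (m∸n+n≡m b≤x) ⟩
  x + a                 ≤⟨ x+a≤y+b ⟩
  y + b                 ≡⟨ cong (_+ b) (sym (m∸n+n≡m a≤y)) ⟩
  ((y ∸ a) + a) + b     ≡⟨ trans (+-assoc (y ∸ a) a b) (cong ((y ∸ a) +_) (+-comm a b)) ⟩
  (y ∸ a) + (b + a)     ∎)
  where open ≤-Reasoning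

∸-from-+-< : ∀ {a b x y} → b ≤ x → a ≤ y → x + a < y + b → x ∸ b < y ∸ a
∸-from-+-< {a} {b} {x} {y} b≤x a≤y lt =
  subst (_≤ y ∸ a) (+-∸-assoc 1 b≤x) (∸-from-+-≤ {a} {b} {suc x} (m≤n⇒m≤1+n b≤x) a≤y lt)

-- Products, inverses and translates of subsets of a group.

module GroupFacts (G : FiniteGroup) where
  open FiniteGroup G public

  group : Group _ _
  group = record { isGroup = isGroup }

  open Group group public using (assoc; identityˡ; identityʳ; inverseˡ; inverseʳ)
  open GroupProperties group public

  infixl 20 _⊙_

  -- The product set AE, which is the out-neighbourhood of `A` for the edges (g , g ∙ e) with e in
  -- `E`. Once `E` contains ε, it includes `A` itself.
  _⊙_ : Subset n → Subset n → Subset n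
  A ⊙ E = ⟪ (λ y → any? λ a → (a ∈? A) ×-dec (((a ⁻¹) ∙ y) ∈? E)) ⟫

  ⊙⁺ : ∀ {A E a y} → a ∈ A → ((a ⁻¹) ∙ y) ∈ E → y ∈ A ⊙ E
  ⊙⁺ {A} {E} {a} {y} a∈A e∈E =
    ∈⟪⟫⁺ (λ y → any? λ a → (a ∈? A) ×-dec (((a ⁻¹) ∙ y) ∈? E)) (a , a∈A , e∈E)

  ⊙⁻ : ∀ {A E y} → y ∈ A ⊙ E → ∃ λ a → a ∈ A × ((a ⁻¹) ∙ y) ∈ E
  ⊙⁻ {A} {E} = ∈⟪⟫⁻ (λ y → any? λ a → (a ∈? A) ×-dec (((a ⁻¹) ∙ y) ∈? E))

  ∙∈⊙ : ∀ {A E a e} → a ∈ A → e ∈ E → (a ∙ e) ∈ A ⊙ E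
  ∙∈⊙ {E = E} {a} {e} a∈A e∈E = ⊙⁺ a∈A (subst (_∈ E) (sym (\\-leftDividesʳ a e)) e∈E)

  ⊆⊙ : ∀ {A E} → ε ∈ E → A ⊆ A ⊙ E
  ⊆⊙ {A} {E} ε∈E {x} x∈A = ⊙⁺ x∈A (subst (_∈ E) (sym (inverseˡ x)) ε∈E)

  inv : Subset n → Subset n
  inv E = ⟪ (λ x → (x ⁻¹) ∈? E) ⟫

  inv⁺ : ∀ {E x} → (x ⁻¹) ∈ E → x ∈ inv E
  inv⁺ {E} = ∈⟪⟫⁺ (λ x → (x ⁻¹) ∈? E)

  inv⁻ : ∀ {E x} → x ∈ inv E → (x ⁻¹) ∈ E
  inv⁻ {E} = ∈⟪⟫⁻ (λ x → (x ⁻¹) ∈? E)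

  ⁻¹∈inv : ∀ {E x} → x ∈ E → (x ⁻¹) ∈ inv E
  ⁻¹∈inv {E} {x} x∈E = inv⁺ (subst (_∈ E) (sym (⁻¹-involutive x)) x∈E)

  inv-inv : ∀ E → inv (inv E) ≡ E
  inv-inv E = ⊆-antisym
    (λ {x} x∈ → subst (_∈ E) (⁻¹-involutive x) (inv⁻ (inv⁻ x∈)))
    (λ x∈ → inv⁺ (⁻¹∈inv x∈))

  -- This is the left translate a⁻¹A, written as a preimage. Left translations are automorphisms of
  -- the digraph.
  translate : Fin n → Subset n → Subset n
  translate a A = ⟪ (λ x → (a ∙ x) ∈? A) ⟫

  translate⁺ : ∀ {a A x} → (a ∙ x) ∈ A → x ∈ translate a A
  translate⁺ {a} {A} = ∈⟪⟫⁺ (λ x → (a ∙ x) ∈? A)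

  translate⁻ : ∀ {a A x} → x ∈ translate a A → (a ∙ x) ∈ A
  translate⁻ {a} {A} = ∈⟪⟫⁻ (λ x → (a ∙ x) ∈? A)

  ∣translate∣≤ : ∀ a A → ∣ translate a A ∣ ≤ ∣ A ∣
  ∣translate∣≤ a A = injection-card (translate a A) A (a ∙_) translate⁻ (λ _ _ → ∙-cancelˡ a _ _)

  ∣translate∣≥ : ∀ a A → ∣ A ∣ ≤ ∣ translate a A ∣
  ∣translate∣≥ a A = injection-card A (translate a A) ((a ⁻¹) ∙_)
    (λ {x} x∈A → translate⁺ (subst (_∈ A) (sym (\\-leftDividesˡ a x)) x∈A))
    (λ _ _ → ∙-cancelˡ (a ⁻¹) _ _)

  translate-⊙ : ∀ a A E → translate a A ⊙ E ⊆ translate a (A ⊙ E)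
  translate-⊙ a A E {y} y∈ with ⊙⁻ y∈
  ... | b , b∈ , e∈E = translate⁺ (⊙⁺ (translate⁻ b∈) (subst (_∈ E) eq e∈E))
    where
    open Relation.Binary.PropositionalEquality.≡-Reasoning
    eq : ((b ⁻¹) ∙ y) ≡ (((a ∙ b) ⁻¹) ∙ (a ∙ y))
    eq = begin
      (b ⁻¹) ∙ y                            ≡⟨ cong ((b ⁻¹) ∙_) (sym (\\-leftDividesʳ a y)) ⟩
      (b ⁻¹) ∙ ((a ⁻¹) ∙ (a ∙ y))           ≡⟨ sym (assoc _ _ _) ⟩
      ((b ⁻¹) ∙ (a ⁻¹)) ∙ (a ∙ y)           ≡⟨ cong (_∙ (a ∙ y)) (sym (⁻¹-anti-homo-∙ a b)) ⟩
      ((a ∙ b) ⁻¹) ∙ (a ∙ y)                ∎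

  -- Left multiplication by x maps K ∪ {x⁻¹} injectively into K, because x ∙ x⁻¹ = ε. By counting,
  -- x⁻¹ already lies in K.
  finite-submonoid⇒subgroup : ∀ K → ε ∈ K → (∀ {x y} → x ∈ K → y ∈ K → (x ∙ y) ∈ K) →
    IsSubgroup G K
  finite-submonoid⇒subgroup K ε∈K closed = ε∈K , (λ x y → closed) , inverse
    where
    inverse : ∀ x → x ∈ K → (x ⁻¹) ∈ K
    inverse x x∈K = ⊆∧≥⇒⊇ (p⊆p∪q ⁅ x ⁻¹ ⁆)
      (injection-card (K ∪ ⁅ x ⁻¹ ⁆) K (x ∙_) maps (λ _ _ → ∙-cancelˡ x _ _))
      (q⊆p∪q K ⁅ x ⁻¹ ⁆ (x∈⁅x⁆ (x ⁻¹)))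
      where
      maps : ∀ {y} → y ∈ K ∪ ⁅ x ⁻¹ ⁆ → (x ∙ y) ∈ K
      maps {y} y∈ with x∈p∪q⁻ K ⁅ x ⁻¹ ⁆ y∈
      ... | inj₁ y∈K = closed x∈K y∈K
      ... | inj₂ y∈s with x∈⁅y⁆⇒x≡y (x ⁻¹) y∈s
      ... | refl = subst (_∈ K) (sym (inverseʳ x)) ε∈K

  module Subgroup {K : Subset n} (K-sub : IsSubgroup G K) where

    ε∈ : ε ∈ K
    ε∈ = proj₁ K-sub

    ∙∈ : ∀ {x y} → x ∈ K → y ∈ K → (x ∙ y) ∈ K
    ∙∈ = proj₁ (proj₂ K-sub) _ _

    ⁻¹∈ : ∀ {x} → x ∈ K → (x ⁻¹) ∈ K
    ⁻¹∈ = proj₂ (proj₂ K-sub) _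

    ∙∈-cancelˡ : ∀ {x y} → x ∈ K → (x ∙ y) ∈ K → y ∈ K
    ∙∈-cancelˡ {x} {y} x∈ xy∈ = subst (_∈ K) (\\-leftDividesʳ x y) (∙∈ (⁻¹∈ x∈) xy∈)

    ∙∈-cancelʳ : ∀ {x y} → y ∈ K → (x ∙ y) ∈ K → x ∈ K
    ∙∈-cancelʳ {x} {y} y∈ xy∈ = subst (_∈ K) (//-rightDividesʳ y x) (∙∈ xy∈ (⁻¹∈ y∈))

    ⁻¹∈-cancel : ∀ {x} → (x ⁻¹) ∈ K → x ∈ K
    ⁻¹∈-cancel {x} x⁻¹∈ = subst (_∈ K) (⁻¹-involutive x) (⁻¹∈ x⁻¹∈)

  -- Fragments, minimality and the atom argument.

  -- A set A is a fragment of the digraph with edges (g , g ∙ e), e ∈ E, when it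
  -- contains ε (harmless by homogeneity) and does not dominate all vertices.
  Fragment : Subset n → Subset n → Set
  Fragment E A = ε ∈ A × ∃ λ z → z ∉ A ⊙ E

  translate-Fragment : ∀ {E A a z} → a ∈ A → z ∉ A ⊙ E → Fragment E (translate a A)
  translate-Fragment {E} {A} {a} {z} a∈A z∉ =
    translate⁺ (subst (_∈ A) (sym (identityʳ a)) a∈A) ,
    (a ⁻¹) ∙ z ,
    λ z∈ → z∉ (subst (_∈ A ⊙ E) (\\-leftDividesˡ a z) (translate⁻ (translate-⊙ a A E z∈)))

  -- With δ(A) = |AE| - |A|, written additively: `A` has least δ among the fragments for `E`, and
  -- least cardinality among the fragments, for `E` or for the reversed digraph, whose δ is at most
  -- δ(A).
  record Minimal (E A : Subset n) : Set where
    field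
      excess : ∀ {C} → Fragment E C → ∣ A ⊙ E ∣ + ∣ C ∣ ≤ ∣ C ⊙ E ∣ + ∣ A ∣
      card   : ∀ {C} → Fragment E C → ∣ C ⊙ E ∣ + ∣ A ∣ ≤ ∣ A ⊙ E ∣ + ∣ C ∣ → ∣ A ∣ ≤ ∣ C ∣
      card⁻  : ∀ {C} → Fragment (inv E) C → ∣ C ⊙ inv E ∣ + ∣ A ∣ ≤ ∣ A ⊙ E ∣ + ∣ C ∣ →
               ∣ A ∣ ≤ ∣ C ∣

  -- A vertex with an out-neighbour outside AE cannot belong to `A`.
  ∁⊙-⊙inv : ∀ A E → ∁ (A ⊙ E) ⊙ inv E ⊆ ∁ A
  ∁⊙-⊙inv A E {x} x∈ with ⊙⁻ x∈
  ... | b , b∈ , e∈ = x∉p⇒x∈∁p λ x∈A →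
    x∈∁p⇒x∉p b∈ (⊙⁺ x∈A (subst (_∈ E) (⁻¹-anti-homo-\\ b x) (inv⁻ e∈)))

  -- The complement of A ⊙ E is a fragment of the reversed digraph whose excess
  -- is at most that of A.
  minimal-half : ∀ {E A} → Fragment E A → Minimal E A → ∣ A ∣ + ∣ A ⊙ E ∣ ≤ n
  minimal-half {E} {A} (ε∈A , z , z∉) min = begin
    ∣ A ∣ + ∣ A ⊙ E ∣          ≤⟨ +-monoˡ-≤ ∣ A ⊙ E ∣ (≤-trans (Minimal.card⁻ min D-fragment D-excess) (∣translate∣≤ z A*)) ⟩
    ∣ A* ∣ + ∣ A ⊙ E ∣         ≡⟨ trans (+-comm ∣ A* ∣ _) (∣p∣+∣∁p∣≡n (A ⊙ E)) ⟩
    n                          ∎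
    where
    open ≤-Reasoning
    A* D : Subset n
    A* = ∁ (A ⊙ E)
    D  = translate z A*
    D-fragment : Fragment (inv E) D
    D-fragment = translate-Fragment (x∉p⇒x∈∁p z∉) (λ ε∈ → x∈∁p⇒x∉p (∁⊙-⊙inv A E ε∈) ε∈A)
    D-excess : ∣ D ⊙ inv E ∣ + ∣ A ∣ ≤ ∣ A ⊙ E ∣ + ∣ D ∣
    D-excess = begin
      ∣ D ⊙ inv E ∣ + ∣ A ∣     ≤⟨ +-monoˡ-≤ ∣ A ∣ (≤-trans (p⊆q⇒∣p∣≤∣q∣ (translate-⊙ z A* (inv E)))
                                     (≤-trans (∣translate∣≤ z (A* ⊙ inv E)) (p⊆q⇒∣p∣≤∣q∣ (∁⊙-⊙inv A E)))) ⟩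
      ∣ ∁ A ∣ + ∣ A ∣           ≡⟨ trans (+-comm ∣ ∁ A ∣ _) (∣p∣+∣∁p∣≡n A) ⟩
      n                         ≡⟨ sym (∣p∣+∣∁p∣≡n (A ⊙ E)) ⟩
      ∣ A ⊙ E ∣ + ∣ A* ∣        ≤⟨ +-monoʳ-≤ ∣ A ⊙ E ∣ (∣translate∣≥ z A*) ⟩
      ∣ A ⊙ E ∣ + ∣ D ∣         ∎

  ⊙-submodular : ∀ A F E → ∣ (A ∪ F) ⊙ E ∣ + ∣ (A ∩ F) ⊙ E ∣ ≤ ∣ A ⊙ E ∣ + ∣ F ⊙ E ∣
  ⊙-submodular A F E = begin
    ∣ (A ∪ F) ⊙ E ∣ + ∣ (A ∩ F) ⊙ E ∣                    ≤⟨ +-mono-≤ (p⊆q⇒∣p∣≤∣q∣ ∪⊆) (p⊆q⇒∣p∣≤∣q∣ ∩⊆) ⟩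
    ∣ (A ⊙ E) ∪ (F ⊙ E) ∣ + ∣ (A ⊙ E) ∩ (F ⊙ E) ∣        ≡⟨ ∣∪∣+∣∩∣ (A ⊙ E) (F ⊙ E) ⟩
    ∣ A ⊙ E ∣ + ∣ F ⊙ E ∣                                ∎
    where
    open ≤-Reasoning
    ∪⊆ : (A ∪ F) ⊙ E ⊆ (A ⊙ E) ∪ (F ⊙ E)
    ∪⊆ y∈ with ⊙⁻ y∈
    ... | a , a∈ , e∈ with x∈p∪q⁻ A F a∈
    ...   | inj₁ a∈A = x∈p∪q⁺ (inj₁ (⊙⁺ a∈A e∈))
    ...   | inj₂ a∈F = x∈p∪q⁺ (inj₂ (⊙⁺ a∈F e∈))
    ∩⊆ : (A ∩ F) ⊙ E ⊆ (A ⊙ E) ∩ (F ⊙ E)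
    ∩⊆ y∈ with ⊙⁻ y∈
    ... | a , a∈ , e∈ with x∈p∩q⁻ A F a∈
    ...   | a∈A , a∈F = ∩⁺ (⊙⁺ a∈A e∈) (⊙⁺ a∈F e∈)

  -- Let `F` be the translate, of the same size and the same δ as `A`. Were A ∩ F smaller than `A`,
  -- minimality would give it a strictly larger δ; since δ(A ∪ F) is at least δ(A), this contradicts
  -- submodularity.
  minimal-⊆-translate : ∀ {E A a} → Fragment E A → Minimal E A → a ∈ A → A ⊆ translate a A
  minimal-⊆-translate {E} {A} {a} (ε∈A , z , z∉) min a∈A =
    λ x∈A → p∩q⊆q A F (⊆∧≥⇒⊇ (p∩q⊆p A F) (≮⇒≥ not-smaller) x∈A)
    where
    open ≤-Reasoning
    F : Subset n
    F = translate a A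
    α ν c u νc νu : ℕ
    α = ∣ A ∣
    ν = ∣ A ⊙ E ∣
    c = ∣ A ∩ F ∣
    u = ∣ A ∪ F ∣
    νc = ∣ (A ∩ F) ⊙ E ∣
    νu = ∣ (A ∪ F) ⊙ E ∣

    ε∈F : ε ∈ F
    ε∈F = translate⁺ (subst (_∈ A) (sym (identityʳ a)) a∈A)

    ∩-fragment : Fragment E (A ∩ F)
    ∩-fragment = ∩⁺ ε∈A ε∈F , z , λ z∈ → z∉ (⊙-mono z∈)
      where
      ⊙-mono : (A ∩ F) ⊙ E ⊆ A ⊙ E
      ⊙-mono y∈ with ⊙⁻ y∈
      ... | b , b∈ , e∈ = ⊙⁺ (p∩q⊆p A F b∈) e∈

    submodular : νu + νc ≤ ν + ν
    submodular = ≤-trans (⊙-submodular A F E)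
      (+-monoʳ-≤ ν (≤-trans (p⊆q⇒∣p∣≤∣q∣ (translate-⊙ a A E)) (∣translate∣≤ a (A ⊙ E))))

    α+α≤u+c : α + α ≤ u + c
    α+α≤u+c = ≤-trans (+-monoʳ-≤ α (∣translate∣≥ a A)) (≤-reflexive (sym (∣∪∣+∣∩∣ A F)))

    u≤α+α : u ≤ α + α
    u≤α+α = ≤-trans (m≤m+n u c) (≤-trans (≤-reflexive (∣∪∣+∣∩∣ A F)) (+-monoʳ-≤ α (∣translate∣≤ a A)))

    ∪-excess : ν + u ≤ νu + α
    ∪-excess with any? (λ y → ¬? (y ∈? (A ∪ F) ⊙ E))
    ... | yes (y , y∉) = Minimal.excess min (x∈p∪q⁺ (inj₁ ε∈A) , y , y∉)
    -- A dominating union is no fragment, so minimality says nothing about it. Instead |A ∪ F| is at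
    -- most 2|A|, and `minimal-half` leaves enough vertices outside the union.
    ... | no ∄y = begin
      ν + u          ≤⟨ +-monoʳ-≤ ν u≤α+α ⟩
      ν + (α + α)    ≡⟨ trans (sym (+-assoc ν α α)) (cong (_+ α) (+-comm ν α)) ⟩
      (α + ν) + α    ≤⟨ +-monoˡ-≤ α (minimal-half (ε∈A , z , z∉) min) ⟩
      n + α          ≡⟨ cong (_+ α) (sym (∣⊤∣≡n n)) ⟩
      ∣ ⊤ {n} ∣ + α  ≤⟨ +-monoˡ-≤ α (p⊆q⇒∣p∣≤∣q∣ {p = ⊤}
                          (λ {y} _ → decidable-stable (y ∈? _) (λ y∉ → ∄y (y , y∉)))) ⟩
      νu + α         ∎

    rearrange₁ : ∀ p q r → (p + q) + (r + q) ≡ (r + p) + (q + q)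
    rearrange₁ = solve-∀

    rearrange₂ : ∀ p q r → (p + p) + (r + q) ≡ (p + q) + (p + r)
    rearrange₂ = solve-∀

    not-smaller : ¬ c < α
    not-smaller c<α = 1+n≰n (begin
      suc ((ν + c) + (ν + u))     ≤⟨ +-mono-≤ (≰⇒> (λ h → <⇒≱ c<α (Minimal.card min ∩-fragment h))) ∪-excess ⟩
      (νc + α) + (νu + α)         ≡⟨ rearrange₁ νc α νu ⟩
      (νu + νc) + (α + α)         ≤⟨ +-mono-≤ submodular α+α≤u+c ⟩
      (ν + ν) + (u + c)           ≡⟨ rearrange₂ ν c u ⟩
      (ν + c) + (ν + u)           ∎)

  -- Inclusion of `A` in a⁻¹A for every a in `A` is closure under multiplication.
  minimal⇒subgroup : ∀ {E A} → Fragment E A → Minimal E A → IsSubgroup G A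
  minimal⇒subgroup {A = A} frag min = finite-submonoid⇒subgroup A (proj₁ frag)
    λ x∈A y∈A → translate⁻ (minimal-⊆-translate frag min x∈A y∈A)

  -- As HE is contained in E, the set AH has no more out-neighbours than `A`. Least excess then
  -- forces AH = A.
  minimal-⊇ : ∀ {E A H} → Fragment E A → Minimal E A → ε ∈ H →
    (∀ {h x} → h ∈ H → x ∈ E → (h ∙ x) ∈ E) → H ⊆ A
  minimal-⊇ {E} {A} {H} (ε∈A , z , z∉) min ε∈H left {h} h∈H =
    ⊆∧≥⇒⊇ A⊆AH (+-cancelˡ-≤ ∣ A ⊙ E ∣ _ _ (≤-trans (Minimal.excess min AH-fragment) (+-monoˡ-≤ ∣ A ∣ (p⊆q⇒∣p∣≤∣q∣ absorb))))
      (subst (_∈ A ⊙ H) (identityˡ h) (∙∈⊙ ε∈A h∈H))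
    where
    A⊆AH : A ⊆ A ⊙ H
    A⊆AH = ⊆⊙ ε∈H
    absorb : (A ⊙ H) ⊙ E ⊆ A ⊙ E
    absorb {y} y∈ with ⊙⁻ y∈
    ... | b , b∈ , e∈ with ⊙⁻ b∈
    ... | a , a∈ , h∈ = ⊙⁺ a∈ (subst (_∈ E)
      (trans (assoc _ _ _) (cong ((a ⁻¹) ∙_) (\\-leftDividesˡ b y))) (left h∈ e∈))
    AH-fragment : Fragment E (A ⊙ H)
    AH-fragment = A⊆AH ε∈A , z , λ z∈ → z∉ (absorb z∈)

  -- The lower bound for fragments of the digraph and of its reverse.

  module Extension {H G' : Subset n} (H-sub : IsSubgroup G H) (G'-sub : IsSubgroup G G')
                   (H⊆G' : H ⊆ G') (k d : ℕ) where

    private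
      module H = Subgroup H-sub
      module G' = Subgroup G'-sub

    -- The properties of E = H ∪ HSH that are used; they are stable under inversion.
    -- Here E ∩ G' and E ∖ G' play the roles of H ∪ HR₁H and HR₂H.
    record Setting (E : Subset n) : Set where
      field
        H⊆E   : H ⊆ E
        left  : ∀ {h x} → h ∈ H → x ∈ E → (h ∙ x) ∈ E
        right : ∀ {x h} → x ∈ E → h ∈ H → (x ∙ h) ∈ E
        G'-generated : ∀ {K} → IsSubgroup G K → H ⊆ K → (∀ {x} → x ∈ E → x ∈ G' → x ∈ K) → G' ⊆ K
        G-generated  : ∀ {K} → IsSubgroup G K → E ⊆ K → ∀ x → x ∈ K
        double-coset : ∀ {K} → IsSubgroup G K → H ⊆ K → ∀ {x a b} → x ∈ E → x ∉ G' → a ∈ G' → b ∈ G' →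
                       ((a ∙ x) ∙ b) ∈ E → x ∈ K → ((a ∙ x) ∙ b) ∈ K
        conn⁺ : ∀ {L z} → L ⊆ G' → (∀ {x h} → x ∈ L → h ∈ H → (x ∙ h) ∈ L) → ε ∈ L →
                z ∈ G' → z ∉ L ⊙ E → ∣ L ∣ + k ≤ ∣ (L ⊙ E) ∩ G' ∣
        conn⁻ : ∀ {L z} → L ⊆ G' → (∀ {x h} → x ∈ L → h ∈ H → (x ∙ h) ∈ L) → ε ∈ L →
                z ∈ G' → z ∉ L ⊙ inv E → ∣ L ∣ + k ≤ ∣ (L ⊙ inv E) ∩ G' ∣
        d≤ : d ≤ ∣ E ∩ ∁ G' ∣

    -- Reversal exchanges `left` with `right` and `conn⁺` with `conn⁻`. In `double-coset` the
    -- inverse of axb is b⁻¹x⁻¹a⁻¹, again of the required form.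
    Setting-inv : ∀ {E} → Setting E → Setting (inv E)
    Setting-inv {E} S = record
      { H⊆E   = λ h∈ → inv⁺ (H⊆E (H.⁻¹∈ h∈))
      ; left  = λ {h} {x} h∈ x∈ → inv⁺ (subst (_∈ E) (sym (⁻¹-anti-homo-∙ h x)) (right (inv⁻ x∈) (H.⁻¹∈ h∈)))
      ; right = λ {x} {h} x∈ h∈ → inv⁺ (subst (_∈ E) (sym (⁻¹-anti-homo-∙ x h)) (left (H.⁻¹∈ h∈) (inv⁻ x∈)))
      ; G'-generated = λ K-sub H⊆K h → G'-generated K-sub H⊆K
          λ x∈E x∈G' → Subgroup.⁻¹∈-cancel K-sub (h (⁻¹∈inv x∈E) (G'.⁻¹∈ x∈G'))
      ; G-generated = λ K-sub h → G-generated K-sub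
          λ x∈E → Subgroup.⁻¹∈-cancel K-sub (h (⁻¹∈inv x∈E))
      ; double-coset = λ {K} K-sub H⊆K {x} {a} {b} x∈ x∉ a∈ b∈ y∈ x∈K →
          Subgroup.⁻¹∈-cancel K-sub (subst (_∈ K) (sym (inverse-axb a x b))
            (double-coset K-sub H⊆K (inv⁻ x∈) (x∉ ∘′ G'.⁻¹∈-cancel) (G'.⁻¹∈ b∈) (G'.⁻¹∈ a∈)
              (subst (_∈ E) (inverse-axb a x b) (inv⁻ y∈)) (Subgroup.⁻¹∈ K-sub x∈K)))
      ; conn⁺ = conn⁻
      ; conn⁻ = subst (λ F → ∀ {L z} → L ⊆ G' → (∀ {x h} → x ∈ L → h ∈ H → (x ∙ h) ∈ L) → ε ∈ L →
                z ∈ G' → z ∉ L ⊙ F → ∣ L ∣ + k ≤ ∣ (L ⊙ F) ∩ G' ∣) (sym (inv-inv E)) conn⁺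
      ; d≤ = ≤-trans d≤ (injection-card (E ∩ ∁ G') (inv E ∩ ∁ G') _⁻¹
          (λ x∈ → ∩∁⁺ (⁻¹∈inv (proj₁ (∩∁⁻ E G' x∈))) (proj₂ (∩∁⁻ E G' x∈) ∘′ G'.⁻¹∈-cancel))
          (λ _ _ → ⁻¹-injective))
      }
      where
      open Setting S
      inverse-axb : ∀ a x b → (((a ∙ x) ∙ b) ⁻¹) ≡ (((b ⁻¹) ∙ (x ⁻¹)) ∙ (a ⁻¹))
      inverse-axb a x b = trans (⁻¹-anti-homo-∙ _ b)
        (trans (cong ((b ⁻¹) ∙_) (⁻¹-anti-homo-∙ a x)) (sym (assoc _ _ _)))

    -- In the application `k` and `d` are κ' and the degree of R₂ multiplied by the order of `H`, as
    -- all sets are counted by elements. The three cases are G' inside `K`, and K ∩ G' dominating G'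
    -- or not.
    subgroup-bound : ∀ {E K z₀} → Setting E → IsSubgroup G K → H ⊆ K → z₀ ∉ K ⊙ E →
      ∣ K ∣ + (∣ G' ∣ ⊓ (k + d)) ≤ ∣ K ⊙ E ∣
    subgroup-bound {E} {K} {z₀} S K-sub H⊆K z₀∉ = bound
      where
      open Setting S
      open ≤-Reasoning
      module K = Subgroup K-sub

      N L P : Subset n
      N = K ⊙ E
      L = K ∩ G'
      -- `P` is the part of the boundary of `K` outside G'. Each case bounds it from below and
      -- concludes by `three-parts`, except the case G' ⊆ K.
      P = (N ∩ ∁ G') ∩ ∁ K

      K⊆N : K ⊆ N
      K⊆N = ⊆⊙ (H⊆E H.ε∈)

      P⁺ : ∀ {x} → x ∈ N → x ∉ G' → x ∉ K → x ∈ P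
      P⁺ x∈N x∉G' x∉K = ∩∁⁺ (∩∁⁺ x∈N x∉G') x∉K

      three-parts : ∣ N ∩ G' ∣ + (∣ K ∩ ∁ G' ∣ + ∣ P ∣) ≤ ∣ N ∣
      three-parts = begin
        ∣ N ∩ G' ∣ + (∣ K ∩ ∁ G' ∣ + ∣ P ∣)   ≤⟨ +-monoʳ-≤ ∣ N ∩ G' ∣ (disjoint-card (K ∩ ∁ G') P (N ∩ ∁ G')
            (λ x∈ → let x∈K , x∉G' = ∩∁⁻ K G' x∈ in ∩∁⁺ (K⊆N x∈K) x∉G')
            (p∩q⊆p _ _)
            (λ x∈ x∈P → proj₂ (∩∁⁻ (N ∩ ∁ G') K x∈P) (proj₁ (∩∁⁻ K G' x∈)))) ⟩
        ∣ N ∩ G' ∣ + ∣ N ∩ ∁ G' ∣             ≡⟨ ∣∩∣+∣∩∁∣ N G' ⟩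
        ∣ N ∣                                 ∎

      rearrange₁ : ∀ l m k d → (l + m) + (k + d) ≡ (l + k) + (m + d)
      rearrange₁ = solve-∀

      rearrange₂ : ∀ l m g → (l + m) + g ≡ g + (m + l)
      rearrange₂ = solve-∀

      G'⊆K-case : G' ⊆ K → ∣ K ∣ + ∣ G' ∣ ≤ ∣ N ∣
      G'⊆K-case G'⊆K with any? (λ r → (r ∈? E) ×-dec ¬? (r ∈? K))
      -- If `E` were contained in `K`, then `K` would be the whole group and would contain `z₀`.
      ... | no ∄r = ⊥-elim (z₀∉ (K⊆N (G-generated K-sub
              (λ {r} r∈E → decidable-stable (r ∈? K) (λ r∉K → ∄r (r , r∈E , r∉K))) z₀)))
      ... | yes (r , r∈E , r∉K) = begin
        ∣ K ∣ + ∣ G' ∣          ≤⟨ +-monoʳ-≤ ∣ K ∣ (p⊆q⇒∣p∣≤∣q∣ G'⊆K) ⟩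
        ∣ K ∣ + ∣ K ∣           ≤⟨ +-monoʳ-≤ ∣ K ∣ (injection-card K (N ∩ ∁ K) (_∙ r)
                                     (λ x∈K → ∩∁⁺ (∙∈⊙ x∈K r∈E) (λ xr∈ → r∉K (K.∙∈-cancelˡ x∈K xr∈)))
                                     (λ _ _ → ∙-cancelʳ r _ _)) ⟩
        ∣ K ∣ + ∣ N ∩ ∁ K ∣     ≤⟨ disjoint-card K (N ∩ ∁ K) N K⊆N (p∩q⊆p _ _)
                                     (λ x∈K x∈ → proj₂ (∩∁⁻ N K x∈) x∈K) ⟩
        ∣ N ∣                   ∎

      module _ {w} (w∈E : w ∈ E) (w∈G' : w ∈ G') (w∉K : w ∉ K) where

        -- E ∖ G' embeds into N ∖ (G' ∪ K): the elements of K are moved out of K by w,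
        -- and the hypothesis on double cosets excludes collisions.
        move : Fin n → Fin n
        move x with x ∈? K
        ... | yes _ = x ∙ w
        ... | no  _ = x

        move-maps : ∀ {x} → x ∈ E ∩ ∁ G' → move x ∈ P
        move-maps {x} x∈ with x ∈? K | ∩∁⁻ E G' x∈
        ... | yes x∈K | x∈E , x∉G' = P⁺ (∙∈⊙ x∈K w∈E)
          (λ xw∈ → x∉G' (G'.∙∈-cancelʳ w∈G' xw∈)) (λ xw∈ → w∉K (K.∙∈-cancelˡ x∈K xw∈))
        ... | no  x∉K | x∈E , x∉G' = P⁺ (subst (_∈ N) (identityˡ x) (∙∈⊙ K.ε∈ x∈E)) x∉G' x∉K

        -- The element x ∙ w is ε ∙ x ∙ w with ε and w in G', so `double-coset` would carry
        -- membership in `K` from x to y.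
        no-collision : ∀ {x y} → x ∈ E ∩ ∁ G' → y ∈ E → x ∈ K → y ∉ K → x ∙ w ≢ y
        no-collision {x} x∈ y∈E x∈K y∉K refl = y∉K (subst (_∈ K) eq
          (double-coset K-sub H⊆K (proj₁ (∩∁⁻ E G' x∈)) (proj₂ (∩∁⁻ E G' x∈)) G'.ε∈ w∈G'
            (subst (_∈ E) (sym eq) y∈E) x∈K))
          where
          eq : ((ε ∙ x) ∙ w) ≡ (x ∙ w)
          eq = cong (_∙ w) (identityˡ x)

        move-injective : ∀ {x y} → x ∈ E ∩ ∁ G' → y ∈ E ∩ ∁ G' → move x ≡ move y → x ≡ y
        move-injective {x} {y} x∈ y∈ eq with x ∈? K | y ∈? K
        ... | yes x∈K | yes y∈K = ∙-cancelʳ w _ _ eq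
        ... | yes x∈K | no  y∉K = ⊥-elim (no-collision x∈ (proj₁ (∩∁⁻ E G' y∈)) x∈K y∉K eq)
        ... | no  x∉K | yes y∈K = ⊥-elim (no-collision y∈ (proj₁ (∩∁⁻ E G' x∈)) y∈K x∉K (sym eq))
        ... | no  x∉K | no  y∉K = eq

        non-dominating-case : ∀ {z} → z ∈ G' → z ∉ L ⊙ E → ∣ K ∣ + (k + d) ≤ ∣ N ∣
        non-dominating-case z∈G' z∉ = begin
          ∣ K ∣ + (k + d)                        ≡⟨ cong (_+ (k + d)) (sym (∣∩∣+∣∩∁∣ K G')) ⟩
          (∣ L ∣ + ∣ K ∩ ∁ G' ∣) + (k + d)       ≡⟨ rearrange₁ (∣ L ∣) (∣ K ∩ ∁ G' ∣) k d ⟩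
          (∣ L ∣ + k) + (∣ K ∩ ∁ G' ∣ + d)       ≤⟨ +-mono-≤ L-part (+-monoʳ-≤ ∣ K ∩ ∁ G' ∣ (≤-trans d≤
                                                      (injection-card (E ∩ ∁ G') P move move-maps move-injective))) ⟩
          ∣ N ∩ G' ∣ + (∣ K ∩ ∁ G' ∣ + ∣ P ∣)    ≤⟨ three-parts ⟩
          ∣ N ∣                                  ∎
          where
          L-part : ∣ L ∣ + k ≤ ∣ N ∩ G' ∣
          L-part = ≤-trans
            (conn⁺ (p∩q⊆q K G')
              (λ x∈ h∈ → let x∈K , x∈G' = x∈p∩q⁻ K G' x∈ in ∩⁺ (K.∙∈ x∈K (H⊆K h∈)) (G'.∙∈ x∈G' (H⊆G' h∈)))
              (∩⁺ K.ε∈ G'.ε∈) z∈G' z∉)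
            (p⊆q⇒∣p∣≤∣q∣ λ y∈ → let y∈LE , y∈G' = x∈p∩q⁻ (L ⊙ E) G' y∈
                                    a , a∈L , e∈E = ⊙⁻ y∈LE
                                in ∩⁺ (⊙⁺ (p∩q⊆p K G' a∈L) e∈E) y∈G')

        -- All of G' lies in `N`, which accounts for the summand |G'|. The elements of `L` must then
        -- be made up for inside `P`.
        dominating-case : (∀ {z} → z ∈ G' → z ∈ L ⊙ E) → ∣ K ∣ + ∣ G' ∣ ≤ ∣ N ∣
        dominating-case G'⊆LE = begin
          ∣ K ∣ + ∣ G' ∣                         ≡⟨ cong (_+ ∣ G' ∣) (sym (∣∩∣+∣∩∁∣ K G')) ⟩
          (∣ L ∣ + ∣ K ∩ ∁ G' ∣) + ∣ G' ∣        ≡⟨ rearrange₂ (∣ L ∣) (∣ K ∩ ∁ G' ∣) (∣ G' ∣) ⟩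
          ∣ G' ∣ + (∣ K ∩ ∁ G' ∣ + ∣ L ∣)        ≤⟨ +-mono-≤ (p⊆q⇒∣p∣≤∣q∣ (λ z∈ → ∩⁺ (G'⊆N z∈) z∈))
                                                      (+-monoʳ-≤ ∣ K ∩ ∁ G' ∣ ∣L∣≤∣P∣) ⟩
          ∣ N ∩ G' ∣ + (∣ K ∩ ∁ G' ∣ + ∣ P ∣)    ≤⟨ three-parts ⟩
          ∣ N ∣                                  ∎
          where
          G'⊆N : G' ⊆ N
          G'⊆N z∈ = let a , a∈L , e∈E = ⊙⁻ (G'⊆LE z∈) in ⊙⁺ (p∩q⊆p K G' a∈L) e∈E
          ∣L∣≤∣P∣ : ∣ L ∣ ≤ ∣ P ∣
          ∣L∣≤∣P∣ with any? (λ r → (r ∈? E) ×-dec ¬? (r ∈? G'))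
          ... | no ∄r = ⊥-elim (z₀∉ (G'⊆N (G-generated G'-sub
                  (λ {r} r∈E → decidable-stable (r ∈? G') (λ r∉G' → ∄r (r , r∈E , r∉G'))) z₀)))
          ... | yes (r , r∈E , r∉G') with r ∈? K
          ...   | no r∉K = injection-card L P (_∙ r)
                  (λ x∈ → let x∈K , x∈G' = x∈p∩q⁻ K G' x∈ in
                    P⁺ (∙∈⊙ x∈K r∈E) (λ xr∈ → r∉G' (G'.∙∈-cancelˡ x∈G' xr∈)) (λ xr∈ → r∉K (K.∙∈-cancelˡ x∈K xr∈)))
                  (λ _ _ → ∙-cancelʳ r _ _)
          -- Right multiplication by r would stay in `K`. Here the left factor r moves `L` out of
          -- G', and the right factor w then moves it out of `K`.
          ...   | yes r∈K = injection-card L P (λ x → (r ∙ x) ∙ w)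
                  (λ x∈ → let x∈K , x∈G' = x∈p∩q⁻ K G' x∈ in
                    P⁺ (∙∈⊙ (K.∙∈ r∈K x∈K) w∈E)
                       (λ rxw∈ → r∉G' (G'.∙∈-cancelʳ x∈G' (G'.∙∈-cancelʳ w∈G' rxw∈)))
                       (λ rxw∈ → w∉K (K.∙∈-cancelˡ (K.∙∈ r∈K x∈K) rxw∈)))
                  (λ _ _ eq → ∙-cancelˡ r _ _ (∙-cancelʳ w _ _ eq))

      bound : ∣ K ∣ + (∣ G' ∣ ⊓ (k + d)) ≤ ∣ N ∣
      bound with any? (λ w → (w ∈? E) ×-dec ((w ∈? G') ×-dec ¬? (w ∈? K)))
      ... | no ∄w = ≤-trans (+-monoʳ-≤ ∣ K ∣ (m⊓n≤m ∣ G' ∣ (k + d))) (G'⊆K-case (G'-generated K-sub H⊆K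
              λ {w} w∈E w∈G' → decidable-stable (w ∈? K) (λ w∉K → ∄w (w , w∈E , w∈G' , w∉K))))
      ... | yes (w , w∈E , w∈G' , w∉K) with any? (λ z → (z ∈? G') ×-dec ¬? (z ∈? L ⊙ E))
      ...   | yes (z , z∈G' , z∉) = ≤-trans (+-monoʳ-≤ ∣ K ∣ (m⊓n≤n ∣ G' ∣ (k + d)))
                (non-dominating-case w∈E w∈G' w∉K z∈G' z∉)
      ...   | no ∄z = ≤-trans (+-monoʳ-≤ ∣ K ∣ (m⊓n≤m ∣ G' ∣ (k + d)))
                (dominating-case w∈E w∈G' w∉K
                  λ {z} z∈G' → decidable-stable (z ∈? _) (λ z∉ → ∄z (z , z∈G' , z∉)))

    _≺_ : ℕ × ℕ → ℕ × ℕ → Set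
    _≺_ = ×-Lex _≡_ _<_ _<_

    -- Excess decides first, cardinality second. In a `Setting` the truncated subtraction is exact,
    -- because `A` is contained in AE.
    size : Subset n → Subset n → ℕ × ℕ
    size E A = ∣ A ⊙ E ∣ ∸ ∣ A ∣ , ∣ A ∣

    -- If A violates the bound but no fragment of smaller size, of the digraph or
    -- its reverse, does, then A is minimal.
    fragment-bound-acc : ∀ {E A} → Setting E → Fragment E A → Acc _≺_ (size E A) →
      ∣ A ∣ + (∣ G' ∣ ⊓ (k + d)) ≤ ∣ A ⊙ E ∣
    fragment-bound-acc {E} {A} S frag (acc rec) with ∣ A ∣ + (∣ G' ∣ ⊓ (k + d)) ≤? ∣ A ⊙ E ∣
    ... | yes bound = bound
    ... | no violated = subgroup-bound S (minimal⇒subgroup frag min)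
            (minimal-⊇ frag min H.ε∈ (Setting.left S)) (proj₂ (proj₂ frag))
      where
      open ≤-Reasoning
      B : ℕ
      B = ∣ G' ∣ ⊓ (k + d)

      ∣C∣≤ : ∀ {F} → Setting F → ∀ C → ∣ C ∣ ≤ ∣ C ⊙ F ∣
      ∣C∣≤ T C = p⊆q⇒∣p∣≤∣q∣ (⊆⊙ (Setting.H⊆E T H.ε∈))

      -- A smaller `C` would satisfy the bound by recursion, and so would `A`, whose excess is at
      -- least that of `C`.
      not-≺ : ∀ {F C} → Setting F → Fragment F C →
        ∣ C ⊙ F ∣ + ∣ A ∣ ≤ ∣ A ⊙ E ∣ + ∣ C ∣ → ¬ size F C ≺ size E A
      not-≺ {F} {C} T frag′ le lt = violated (+-cancelˡ-≤ (∣ C ∣) _ _ (begin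
        ∣ C ∣ + (∣ A ∣ + B)     ≡⟨ rearrange (∣ C ∣) (∣ A ∣) B ⟩
        (∣ C ∣ + B) + ∣ A ∣     ≤⟨ +-monoˡ-≤ ∣ A ∣ (fragment-bound-acc T frag′ (rec lt)) ⟩
        ∣ C ⊙ F ∣ + ∣ A ∣       ≤⟨ le ⟩
        ∣ A ⊙ E ∣ + ∣ C ∣       ≡⟨ +-comm (∣ A ⊙ E ∣) _ ⟩
        ∣ C ∣ + ∣ A ⊙ E ∣       ∎))
        where
        rearrange : ∀ c a b → c + (a + b) ≡ (c + b) + a
        rearrange = solve-∀

      card-of : ∀ {F C} → Setting F → Fragment F C →
        ∣ C ⊙ F ∣ + ∣ A ∣ ≤ ∣ A ⊙ E ∣ + ∣ C ∣ → ∣ A ∣ ≤ ∣ C ∣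
      card-of {F} {C} T frag′ le = ≮⇒≥ λ lt → not-≺ T frag′ le
        (case-≤ lt (m≤n⇒m<n∨m≡n (∸-from-+-≤ (∣C∣≤ T C) (∣C∣≤ S A) le)))
        where
        case-≤ : ∣ C ∣ < ∣ A ∣ →
          ∣ C ⊙ F ∣ ∸ ∣ C ∣ < ∣ A ⊙ E ∣ ∸ ∣ A ∣ ⊎ ∣ C ⊙ F ∣ ∸ ∣ C ∣ ≡ ∣ A ⊙ E ∣ ∸ ∣ A ∣ →
          size F C ≺ size E A
        case-≤ lt (inj₁ δ<) = inj₁ δ<
        case-≤ lt (inj₂ δ≡) = inj₂ (δ≡ , lt)

      min : Minimal E A
      min = record
        { excess = λ {C} frag′ → ≮⇒≥ λ lt → not-≺ S frag′ (<⇒≤ lt)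
            (inj₁ (∸-from-+-< (∣C∣≤ S C) (∣C∣≤ S A) lt))
        ; card  = card-of S
        ; card⁻ = card-of (Setting-inv S)
        }

    fragment-bound : ∀ {E A} → Setting E → Fragment E A →
      ∣ A ∣ + (∣ G' ∣ ⊓ (k + d)) ≤ ∣ A ⊙ E ∣
    fragment-bound S frag = fragment-bound-acc S frag (×-wellFounded <-wellFounded <-wellFounded _)

    -- Translating by `a` brings ε into the set, as a fragment requires; its new neighbours all lie
    -- in `X`.
    separator-bound : ∀ {E} (A X : Subset n) {a z} → Setting E → a ∈ A → z ∉ A ⊙ E → A ⊙ E ⊆ A ∪ X →
      ∣ G' ∣ ⊓ (k + d) ≤ ∣ X ∣
    separator-bound {E} A X {a} S a∈A z∉ AE⊆A∪X = +-cancelˡ-≤ (∣ A ∣) _ _ (begin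
      ∣ A ∣ + (∣ G' ∣ ⊓ (k + d))                   ≤⟨ +-monoˡ-≤ _ (∣translate∣≥ a A) ⟩
      ∣ translate a A ∣ + (∣ G' ∣ ⊓ (k + d))       ≤⟨ fragment-bound S (translate-Fragment a∈A z∉) ⟩
      ∣ translate a A ⊙ E ∣                        ≤⟨ p⊆q⇒∣p∣≤∣q∣ (translate-⊙ a A E) ⟩
      ∣ translate a (A ⊙ E) ∣                      ≤⟨ ∣translate∣≤ a (A ⊙ E) ⟩
      ∣ A ⊙ E ∣                                    ≤⟨ p⊆q⇒∣p∣≤∣q∣ AE⊆A∪X ⟩
      ∣ A ∪ X ∣                                    ≤⟨ m≤m+n (∣ A ∪ X ∣) (∣ A ∩ X ∣) ⟩
      ∣ A ∪ X ∣ + ∣ A ∩ X ∣                        ≡⟨ ∣∪∣+∣∩∣ A X ⟩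
      ∣ A ∣ + ∣ X ∣                                ∎)
      where open ≤-Reasoning

  -- Double cosets of a subgroup.

  module DoubleCosets {H : Subset n} (H-sub : IsSubgroup G H) where

    private module H = Subgroup H-sub

    DC⁺ : ∀ {s x a b} → a ∈ H → b ∈ H → x ≡ ((a ∙ s) ∙ b) → x ∈ DoubleCoset G H s H
    DC⁺ {s} {x} {a} {b} a∈ b∈ eq = ∈⟪⟫⁺
      (λ x → any? λ a → any? λ b → (a ∈? H) ×-dec ((b ∈? H) ×-dec (x ≟ ((a ∙ s) ∙ b))))
      (a , b , a∈ , b∈ , eq)

    DC⁻ : ∀ {s x} → x ∈ DoubleCoset G H s H →
      ∃ λ a → ∃ λ b → a ∈ H × b ∈ H × x ≡ ((a ∙ s) ∙ b)
    DC⁻ {s} = ∈⟪⟫⁻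
      (λ x → any? λ a → any? λ b → (a ∈? H) ×-dec ((b ∈? H) ×-dec (x ≟ ((a ∙ s) ∙ b))))

    DC-refl : ∀ s → s ∈ DoubleCoset G H s H
    DC-refl s = DC⁺ H.ε∈ H.ε∈ (sym (trans (identityʳ _) (identityˡ s)))

    DC-left : ∀ {s x h} → h ∈ H → x ∈ DoubleCoset G H s H → (h ∙ x) ∈ DoubleCoset G H s H
    DC-left {s} {h = h} h∈ x∈ with DC⁻ x∈
    ... | a , b , a∈ , b∈ , refl = DC⁺ (H.∙∈ h∈ a∈) b∈
      (trans (sym (assoc h (a ∙ s) b)) (cong (_∙ b) (sym (assoc h a s))))

    DC-right : ∀ {s x h} → x ∈ DoubleCoset G H s H → h ∈ H → (x ∙ h) ∈ DoubleCoset G H s H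
    DC-right {s} {h = h} x∈ h∈ with DC⁻ x∈
    ... | a , b , a∈ , b∈ , refl = DC⁺ a∈ (H.∙∈ b∈ h∈) (assoc _ b h)

    DC-sym : ∀ {s x} → x ∈ DoubleCoset G H s H → s ∈ DoubleCoset G H x H
    DC-sym {s} x∈ with DC⁻ x∈
    ... | a , b , a∈ , b∈ , refl = DC⁺ (H.⁻¹∈ a∈) (H.⁻¹∈ b∈) (sym (begin
      ((a ⁻¹) ∙ ((a ∙ s) ∙ b)) ∙ (b ⁻¹)    ≡⟨ assoc _ _ _ ⟩
      (a ⁻¹) ∙ (((a ∙ s) ∙ b) ∙ (b ⁻¹))    ≡⟨ cong ((a ⁻¹) ∙_) (//-rightDividesʳ b (a ∙ s)) ⟩
      (a ⁻¹) ∙ (a ∙ s)                     ≡⟨ \\-leftDividesʳ a s ⟩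
      s                                    ∎))
      where open Relation.Binary.PropositionalEquality.≡-Reasoning

    DC-⊆ : ∀ {s x} → x ∈ DoubleCoset G H s H → DoubleCoset G H x H ⊆ DoubleCoset G H s H
    DC-⊆ x∈ y∈ with DC⁻ y∈
    ... | a , b , a∈ , b∈ , refl = DC-right (DC-left a∈ x∈) b∈

    DC-≡ : ∀ {s x} → x ∈ DoubleCoset G H s H → DoubleCoset G H x H ≡ DoubleCoset G H s H
    DC-≡ x∈ = ⊆-antisym (DC-⊆ x∈) (DC-⊆ (DC-sym x∈))

    DC-⊆-subgroup : ∀ {K s x} → IsSubgroup G K → H ⊆ K → x ∈ DoubleCoset G H s H → s ∈ K → x ∈ K
    DC-⊆-subgroup K-sub H⊆K x∈ s∈K with DC⁻ x∈
    ... | a , b , a∈ , b∈ , refl = ∙∈ (∙∈ (H⊆K a∈) s∈K) (H⊆K b∈)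
      where open Subgroup K-sub

  -- The coset digraph lifted to group elements, and its separators.

  module CosetDigraph {H S : Subset n} (H-sub : IsSubgroup G H) where

    open DoubleCosets H-sub
    private module H = Subgroup H-sub

    HSH : Subset n
    HSH = ⟪ (λ x → any? λ s → (s ∈? S) ×-dec (x ∈? DoubleCoset G H s H)) ⟫

    HSH⁺ : ∀ {s x} → s ∈ S → x ∈ DoubleCoset G H s H → x ∈ HSH
    HSH⁺ {s} s∈S x∈ =
      ∈⟪⟫⁺ (λ x → any? λ s → (s ∈? S) ×-dec (x ∈? DoubleCoset G H s H)) (s , s∈S , x∈)

    HSH⁻ : ∀ {x} → x ∈ HSH → ∃ λ s → s ∈ S × x ∈ DoubleCoset G H s H
    HSH⁻ = ∈⟪⟫⁻ (λ x → any? λ s → (s ∈? S) ×-dec (x ∈? DoubleCoset G H s H))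

    -- Edges from gH to yH correspond to g⁻¹y in HSH. Adding `H` makes AE the closed
    -- out-neighbourhood and puts ε in `E`.
    E : Subset n
    E = H ∪ HSH

    E⁻ : ∀ {x} → x ∈ E → x ∈ H ⊎ ∃ λ s → s ∈ S × x ∈ DoubleCoset G H s H
    E⁻ x∈ with x∈p∪q⁻ H HSH x∈
    ... | inj₁ x∈H = inj₁ x∈H
    ... | inj₂ x∈HSH = inj₂ (HSH⁻ x∈HSH)

    H⊆E : H ⊆ E
    H⊆E x∈ = x∈p∪q⁺ (inj₁ x∈)

    DC⊆E : ∀ {s} → s ∈ S → DoubleCoset G H s H ⊆ E
    DC⊆E s∈S x∈ = x∈p∪q⁺ (inj₂ (HSH⁺ s∈S x∈))

    E-left : ∀ {h x} → h ∈ H → x ∈ E → (h ∙ x) ∈ E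
    E-left h∈ x∈ with E⁻ x∈
    ... | inj₁ x∈H = H⊆E (H.∙∈ h∈ x∈H)
    ... | inj₂ (s , s∈ , x∈DC) = DC⊆E s∈ (DC-left h∈ x∈DC)

    E-right : ∀ {x h} → x ∈ E → h ∈ H → (x ∙ h) ∈ E
    E-right x∈ h∈ with E⁻ x∈
    ... | inj₁ x∈H = H⊆E (H.∙∈ x∈H h∈)
    ... | inj₂ (s , s∈ , x∈DC) = DC⊆E s∈ (DC-right x∈DC h∈)

    chain : ∀ g a y → (((g ⁻¹) ∙ a) ∙ ((a ⁻¹) ∙ y)) ≡ ((g ⁻¹) ∙ y)
    chain g a y = trans (assoc _ _ _) (cong ((g ⁻¹) ∙_) (\\-leftDividesˡ a y))

    edge⇒∈DC : ∀ {T g y} → Edge G H T g y → ∃ λ t → t ∈ T × ((g ⁻¹) ∙ y) ∈ DoubleCoset G H t H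
    edge⇒∈DC {g = g} {y} (h , h' , t , h∈ , h'∈ , t∈ , eq) = t , t∈ , DC⁺ h∈ (H.⁻¹∈ h'∈) (begin
      (g ⁻¹) ∙ y                               ≡⟨ cong ((g ⁻¹) ∙_) (sym (//-rightDividesʳ h' y)) ⟩
      (g ⁻¹) ∙ ((y ∙ h') ∙ (h' ⁻¹))            ≡⟨ cong (λ u → (g ⁻¹) ∙ (u ∙ (h' ⁻¹))) (sym eq) ⟩
      (g ⁻¹) ∙ (((g ∙ h) ∙ t) ∙ (h' ⁻¹))       ≡⟨ cong (λ u → (g ⁻¹) ∙ (u ∙ (h' ⁻¹))) (assoc g h t) ⟩
      (g ⁻¹) ∙ ((g ∙ (h ∙ t)) ∙ (h' ⁻¹))       ≡⟨ cong ((g ⁻¹) ∙_) (assoc g _ _) ⟩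
      (g ⁻¹) ∙ (g ∙ ((h ∙ t) ∙ (h' ⁻¹)))       ≡⟨ \\-leftDividesʳ g _ ⟩
      (h ∙ t) ∙ (h' ⁻¹)                        ∎)
      where open Relation.Binary.PropositionalEquality.≡-Reasoning

    edge⇒∈E : ∀ {T g y} → T ⊆ S → Edge G H T g y → ((g ⁻¹) ∙ y) ∈ E
    edge⇒∈E T⊆S edge = let t , t∈ , y∈ = edge⇒∈DC edge in DC⊆E (T⊆S t∈) y∈

    ∈DC⇒edge : ∀ {s g y} → s ∈ S → ((g ⁻¹) ∙ y) ∈ DoubleCoset G H s H → Edge G H S g y
    ∈DC⇒edge {s} {g} {y} s∈ y∈ with DC⁻ y∈
    ... | a , b , a∈ , b∈ , eq = a , b ⁻¹ , s , a∈ , H.⁻¹∈ b∈ , s∈ , sym (begin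
      y ∙ (b ⁻¹)                               ≡⟨ cong (_∙ (b ⁻¹)) (sym (\\-leftDividesˡ g y)) ⟩
      (g ∙ ((g ⁻¹) ∙ y)) ∙ (b ⁻¹)              ≡⟨ cong (λ u → (g ∙ u) ∙ (b ⁻¹)) eq ⟩
      (g ∙ ((a ∙ s) ∙ b)) ∙ (b ⁻¹)             ≡⟨ assoc g _ _ ⟩
      g ∙ (((a ∙ s) ∙ b) ∙ (b ⁻¹))             ≡⟨ cong (g ∙_) (//-rightDividesʳ b (a ∙ s)) ⟩
      g ∙ (a ∙ s)                              ≡⟨ sym (assoc g a s) ⟩
      (g ∙ a) ∙ s                              ∎)
      where open Relation.Binary.PropositionalEquality.≡-Reasoning

    extend : ∀ {X g a y} → Path G ⊤ H S X g a → ((a ⁻¹) ∙ y) ∈ E → y ∉ X → Path G ⊤ H S X g y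
    extend (step edge g''∈ g''∉ path) y∈ y∉ = step edge g''∈ g''∉ (extend path y∈ y∉)
    -- Here `a` is only known to share the coset of g, so the step is transferred to g by HE ⊆ E:
    -- g⁻¹y = (g⁻¹a)(a⁻¹y).
    extend {g = g} {a} {y} (here a∈) y∈ y∉
      with E⁻ (subst (_∈ E) (chain g a y) (E-left a∈ y∈))
    ... | inj₁ g⁻¹y∈H = here g⁻¹y∈H
    ... | inj₂ (s , s∈ , g⁻¹y∈) = step (∈DC⇒edge s∈ g⁻¹y∈) ∈⊤ y∉ (here (subst (_∈ H) (sym (inverseˡ y)) H.ε∈))

    -- The bound is stable under double negation, so reachability may be assumed decidable.
    separator-≥ : ∀ {B X} → ¬ StronglyConnectedAfter G ⊤ H S X →
      (∀ A {g g'} → g ∈ A → g' ∉ A ⊙ E → A ⊙ E ⊆ A ∪ X → B ≤ ∣ X ∣) → B ≤ ∣ X ∣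
    separator-≥ {B} {X} ¬sc bound = decidable-stable (B ≤? ∣ X ∣) λ ¬B≤X →
      ¬¬-∀ {Q = λ g → ∀ g' → Dec (Path G ⊤ H S X g g')} (λ g → ¬¬-∀ (λ g' → ¬¬-Dec)) λ path? →
      ¬sc λ g g' _ g∉X _ g'∉X → decidable-stable (path? g g') λ ¬path →
      -- `A` consists of the elements outside `X` reachable from g. Every step leaving it ends in
      -- `X`, and g' is not among its out-neighbours.
      let R = ⟪ path? g ⟫
          A = R ∩ ∁ X
      in ¬B≤X (bound A
        (∩∁⁺ (∈⟪⟫⁺ (path? g) (here (subst (_∈ H) (sym (inverseˡ g)) H.ε∈))) g∉X)
        (λ g'∈ → let a , a∈ , e∈ = ⊙⁻ g'∈ in
          ¬path (extend (∈⟪⟫⁻ (path? g) (proj₁ (∩∁⁻ R X a∈))) e∈ g'∉X))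
        (λ {y} y∈ → let a , a∈ , e∈ = ⊙⁻ y∈ in
          A∪X⁺ (path? g) y (extend (∈⟪⟫⁻ (path? g) (proj₁ (∩∁⁻ R X a∈))) e∈)))
      where
      A∪X⁺ : ∀ {P : Fin n → Set} (P? : ∀ x → Dec (P x)) y → (y ∉ X → P y) → y ∈ (⟪ P? ⟫ ∩ ∁ X) ∪ X
      A∪X⁺ P? y py with y ∈? X
      ... | yes y∈X = x∈p∪q⁺ (inj₂ y∈X)
      ... | no  y∉X = x∈p∪q⁺ (inj₁ (∩∁⁺ (∈⟪⟫⁺ P? (py y∉X)) y∉X))

    -- Connectivity of the smaller digraph in terms of boundaries.

    module Connectivity {G' R₁ : Subset n} (G'-sub : IsSubgroup G G') (H⊆G' : H ⊆ G')
      (R₁⊆S : R₁ ⊆ S) (κ' : ℕ) (κ'-conn : IsVertexConnectivity G G' H R₁ κ') where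

      private module G' = Subgroup G'-sub

      boundary : Subset n → Subset n → Subset n
      boundary F L = ((L ⊙ F) ∩ G') ∩ ∁ L

      boundary⁺ : ∀ {F L x} → x ∈ L ⊙ F → x ∈ G' → x ∉ L → x ∈ boundary F L
      boundary⁺ x∈ x∈G' x∉L = ∩∁⁺ (∩⁺ x∈ x∈G') x∉L

      boundary⊆G' : ∀ {F L} → boundary F L ⊆ G'
      boundary⊆G' {F} {L} x∈ = p∩q⊆q (L ⊙ F) G' (p∩q⊆p _ (∁ L) x∈)

      boundary⊆⊙ : ∀ {F L} → boundary F L ⊆ L ⊙ F
      boundary⊆⊙ {F} {L} x∈ = p∩q⊆p (L ⊙ F) G' (p∩q⊆p _ (∁ L) x∈)

      boundary-disjoint : ∀ {F L x} → x ∈ L → x ∉ boundary F L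
      boundary-disjoint {F} {L} x∈L x∈ = proj₂ (∩∁⁻ ((L ⊙ F) ∩ G') L x∈) x∈L

      module _ {F L : Subset n} (F-right : ∀ {x h} → x ∈ F → h ∈ H → (x ∙ h) ∈ F)
               (H⊆F : H ⊆ F) (L⊆G' : L ⊆ G') (L-right : ∀ {x h} → x ∈ L → h ∈ H → (x ∙ h) ∈ L) where

        boundary-saturated : Saturated G G' H (boundary F L)
        boundary-saturated = boundary⊆G' , λ x h x∈ h∈ →
          let a , a∈ , e∈ = ⊙⁻ (boundary⊆⊙ {F} {L} x∈) in
          boundary⁺ (⊙⁺ a∈ (subst (_∈ F) (assoc _ x h) (F-right e∈ h∈)))
            (G'.∙∈ (boundary⊆G' {F} {L} x∈) (H⊆G' h∈))
            (λ xh∈L → boundary-disjoint {F} {L} (subst (_∈ L) (//-rightDividesʳ h x) (L-right xh∈L (H.⁻¹∈ h∈))) x∈)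

        boundary-bound : ∀ {k} → k ≤ ∣ boundary F L ∣ → ∣ L ∣ + k ≤ ∣ (L ⊙ F) ∩ G' ∣
        boundary-bound k≤ = ≤-trans (+-monoʳ-≤ ∣ L ∣ k≤)
          (disjoint-card L (boundary F L) ((L ⊙ F) ∩ G')
            (λ x∈ → ∩⁺ (⊆⊙ (H⊆F H.ε∈) x∈) (L⊆G' x∈)) (p∩q⊆p _ _) boundary-disjoint)

        -- `F` will be `E` or `inv E`. In both cases the boundary of `L` is a separator of the same
        -- digraph, so one κ' serves both directions.
        conn : ¬ StronglyConnectedAfter G G' H R₁ (boundary F L) → ¬ Complete G G' H R₁ →
          ∣ L ∣ + κ' * ∣ H ∣ ≤ ∣ (L ⊙ F) ∩ G' ∣
        conn ¬sc ¬complete = boundary-bound (from κ'-conn)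
          where
          from : IsVertexConnectivity G G' H R₁ κ' → κ' * ∣ H ∣ ≤ ∣ boundary F L ∣
          from (inj₁ (complete , _)) = ⊥-elim (¬complete complete)
          from (inj₂ (_ , _ , least)) = least (boundary F L) boundary-saturated ¬sc

      L-cancel : ∀ {L g g'} → (∀ {x h} → x ∈ L → h ∈ H → (x ∙ h) ∈ L) →
        SameCoset G H g g' → g ∈ L → g' ∈ L
      L-cancel {L} {g} {g'} L-right g∼g' g∈ = subst (_∈ L) (\\-leftDividesˡ g g') (L-right g∈ g∼g')

      SameCoset-sym : ∀ {g g'} → SameCoset G H g g' → SameCoset G H g' g
      SameCoset-sym {g} {g'} g∼g' = subst (_∈ H) (⁻¹-anti-homo-\\ g g') (H.⁻¹∈ g∼g')

      -- A path starting in `L` cannot leave `L` without meeting the boundary, so z is not reachable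
      -- from ε.
      conn⁺ : ∀ {L z} → L ⊆ G' → (∀ {x h} → x ∈ L → h ∈ H → (x ∙ h) ∈ L) → ε ∈ L →
        z ∈ G' → z ∉ L ⊙ E → ∣ L ∣ + κ' * ∣ H ∣ ≤ ∣ (L ⊙ E) ∩ G' ∣
      conn⁺ {L} {z} L⊆G' L-right ε∈L z∈G' z∉ = conn E-right H⊆E L⊆G' L-right
        (λ sc → z∉ (⊆⊙ (H⊆E H.ε∈) (stays ε∈L
          (sc ε z G'.ε∈ (boundary-disjoint ε∈L) z∈G' (λ z∈ → z∉ (boundary⊆⊙ z∈))))))
        (λ complete → z∉ (⊙⁺ ε∈L (edge⇒∈E R₁⊆S
          (complete ε z G'.ε∈ z∈G' (λ ε∼z → z∉ (⊙⁺ ε∈L (H⊆E ε∼z)))))))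
        where
        stays : ∀ {g g'} → g ∈ L → Path G G' H R₁ (boundary E L) g g' → g' ∈ L
        stays g∈ (here g∼g') = L-cancel L-right g∼g' g∈
        stays g∈ (step {g'' = g''} edge g''∈ g''∉ path) = stays
          (decidable-stable (g'' ∈? L) λ g''∉L →
            g''∉ (boundary⁺ (⊙⁺ g∈ (edge⇒∈E R₁⊆S edge)) g''∈ g''∉L)) path

      -- For `inv E` the boundary consists of in-neighbours, so a path starting outside `L` cannot
      -- enter it: ε is not reachable from z.
      conn⁻ : ∀ {L z} → L ⊆ G' → (∀ {x h} → x ∈ L → h ∈ H → (x ∙ h) ∈ L) → ε ∈ L →
        z ∈ G' → z ∉ L ⊙ inv E → ∣ L ∣ + κ' * ∣ H ∣ ≤ ∣ (L ⊙ inv E) ∩ G' ∣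
      conn⁻ {L} {z} L⊆G' L-right ε∈L z∈G' z∉ = conn
        (λ {x} {h} x∈ h∈ → inv⁺ (subst (_∈ E) (sym (⁻¹-anti-homo-∙ x h)) (E-left (H.⁻¹∈ h∈) (inv⁻ x∈))))
        H⊆invE L⊆G' L-right
        (λ sc → avoids z∈G' (λ z∈L → z∉ (⊆⊙ (H⊆invE H.ε∈) z∈L)) (λ z∈ → z∉ (boundary⊆⊙ z∈))
          (sc z ε z∈G' (λ z∈ → z∉ (boundary⊆⊙ z∈)) G'.ε∈ (boundary-disjoint ε∈L)) ε∈L)
        (λ complete → z∉ (back ε∈L (edge⇒∈E R₁⊆S
          (complete z ε z∈G' G'.ε∈ (λ z∼ε → z∉ (back ε∈L (H⊆E z∼ε)))))))
        where
        H⊆invE : H ⊆ inv E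
        H⊆invE h∈ = inv⁺ (H⊆E (H.⁻¹∈ h∈))
        back : ∀ {g a} → a ∈ L → ((g ⁻¹) ∙ a) ∈ E → g ∈ L ⊙ inv E
        back {g} {a} a∈ e∈ = ⊙⁺ a∈ (inv⁺ (subst (_∈ E) (sym (⁻¹-anti-homo-\\ a g)) e∈))
        avoids : ∀ {g g'} → g ∈ G' → g ∉ L → g ∉ boundary (inv E) L →
          Path G G' H R₁ (boundary (inv E) L) g g' → g' ∉ L
        avoids g∈ g∉L g∉ (here g∼g') g'∈L = g∉L (L-cancel L-right (SameCoset-sym g∼g') g'∈L)
        avoids g∈ g∉L g∉ (step edge g''∈ g''∉ path) = avoids g''∈
          (λ g''∈L → g∉ (boundary⁺ (back g''∈L (edge⇒∈E R₁⊆S edge)) g∈ g∉L)) g''∉ path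

  -- Counting the elements of the double cosets of R.

  dSum-bound : ∀ {H R : Subset n} → IsSubgroup G H → ⦃ _ : NonZero ∣ H ∣ ⦄ →
    (∀ s t → s ∈ R → t ∈ R → s ≢ t → DoubleCoset G H s H ≢ DoubleCoset G H t H) →
    ∀ Y → (∀ {s} → s ∈ R → DoubleCoset G H s H ⊆ Y) → dSum G H R * ∣ H ∣ ≤ ∣ Y ∣
  dSum-bound {H} {R} H-sub distinct Y DC⊆Y = sum-disjoint F w (∣ H ∣) w≤
    (AllPairs.map (λ {s} {t} → disjoint s t) (allFin⁺ n)) Y (All.universal F⊆Y (allFin n))
    where
    open DoubleCosets H-sub
    -- The sum runs over all elements of the group, so those outside `R` receive the empty set and
    -- weight 0.
    F : Fin n → Subset n
    F s = if does (s ∈? R) then DoubleCoset G H s H else ⊥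
    w : Fin n → ℕ
    w s = if does (s ∈? R) then d G H s else 0
    w≤ : ∀ s → w s * ∣ H ∣ ≤ ∣ F s ∣
    w≤ s with s ∈? R
    ... | yes _ = m/n*n≤m _ (∣ H ∣)
    ... | no  _ = z≤n
    F⊆Y : ∀ s → F s ⊆ Y
    F⊆Y s x∈ with s ∈? R
    ... | yes s∈R = DC⊆Y s∈R x∈
    ... | no  _   = ⊥-elim (∉⊥ x∈)
    disjoint : ∀ s t → s ≢ t → ∀ {x} → x ∈ F s → x ∉ F t
    disjoint s t s≢t x∈s x∈t with s ∈? R | t ∈? R
    -- A common element would make the two double cosets equal.
    ... | yes s∈R | yes t∈R = distinct s t s∈R t∈R s≢t (trans (sym (DC-≡ x∈s)) (DC-≡ x∈t))
    ... | no _    | _       = ∉⊥ x∈s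
    ... | yes _   | no _    = ∉⊥ x∈t

-- The connectivity bound for the coset digraph.

theorem14 : (G : FiniteGroup) (H S R₁ R₂ G' : Sub G) →
    IsSubgroup G H → ⦃ _ : NonZero ∣ H ∣ ⦄ →
    (∀ s → s ∈ S → s ∉ H) →
    (∀ s t → s ∈ S → t ∈ S → s ≢ t → DoubleCoset G H s H ≢ DoubleCoset G H t H) →
    (∀ x → Generated G (H ∪ S) x) →
    ¬ Complete G ⊤ H S →
    R₁ ∪ R₂ ≡ S → R₁ ∩ R₂ ≡ ⊥ →
    (∀ x → (x ∈ G' → Generated G (H ∪ R₁) x) × (Generated G (H ∪ R₁) x → x ∈ G')) →
    (∀ r → r ∈ R₂ → r ∉ G') →
    (∀ r s → r ∈ R₂ → s ∈ R₂ → DoubleCoset G G' r G' ≡ DoubleCoset G G' s G' →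
    ∀ x → (Generated G (H ∪ ⁅ r ⁆) x → Generated G (H ∪ ⁅ s ⁆) x)
    × (Generated G (H ∪ ⁅ s ⁆) x → Generated G (H ∪ ⁅ r ⁆) x)) →
    ∀ (κ κ' : ℕ) → IsVertexConnectivity G ⊤ H S κ → IsVertexConnectivity G G' H R₁ κ' →
    ((∣ G' ∣ / ∣ H ∣) ⊓ (κ' + dSum G H R₂)) ≤ κ
theorem14 G H S R₁ R₂ G' H-sub _ distinct generated ¬complete R₁∪R₂≡S _ G'-gen R₂∉G' same-gen κ κ'
  (inj₁ (complete , _)) κ'-conn = ⊥-elim (¬complete complete)
theorem14 G H S R₁ R₂ G' H-sub _ distinct generated ¬complete R₁∪R₂≡S _ G'-gen R₂∉G' same-gen κ κ'
  (inj₂ (_ , (X , _ , κ≡∣X∣ , ¬sc) , _)) κ'-conn = conclude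
    (⊓-sel ∣G'∣ (κ' * ∣ H ∣ + dSum G H R₂ * ∣ H ∣))
  where
  open GroupFacts G
  open DoubleCosets H-sub
  open CosetDigraph {H} {S} H-sub

  ∣G'∣ : ℕ
  ∣G'∣ = ∣ G' ∣

  R₁⊆S : R₁ ⊆ S
  R₁⊆S r∈ = subst (_ ∈_) R₁∪R₂≡S (p⊆p∪q R₂ r∈)

  R₂⊆S : R₂ ⊆ S
  R₂⊆S r∈ = subst (_ ∈_) R₁∪R₂≡S (q⊆p∪q R₁ R₂ r∈)

  S⁻ : ∀ {s} → s ∈ S → s ∈ R₁ ⊎ s ∈ R₂
  S⁻ s∈ = x∈p∪q⁻ R₁ R₂ (subst (_ ∈_) (sym R₁∪R₂≡S) s∈)

  G'⁺ : ∀ {x} → Generated G (H ∪ R₁) x → x ∈ G'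
  G'⁺ = proj₂ (G'-gen _)

  G'⁻ : ∀ {x} → x ∈ G' → Generated G (H ∪ R₁) x
  G'⁻ = proj₁ (G'-gen _)

  H⊆G' : H ⊆ G'
  H⊆G' x∈ = G'⁺ λ K _ A⊆K → A⊆K (p⊆p∪q R₁ x∈)

  R₁⊆G' : R₁ ⊆ G'
  R₁⊆G' x∈ = G'⁺ λ K _ A⊆K → A⊆K (q⊆p∪q H R₁ x∈)

  G'-sub : IsSubgroup G G'
  G'-sub = G'⁺ (λ K K-sub _ → Subgroup.ε∈ K-sub)
         , (λ x y x∈ y∈ → G'⁺ λ K K-sub A⊆K → Subgroup.∙∈ K-sub (G'⁻ x∈ K K-sub A⊆K) (G'⁻ y∈ K K-sub A⊆K))
         , (λ x x∈ → G'⁺ λ K K-sub A⊆K → Subgroup.⁻¹∈ K-sub (G'⁻ x∈ K K-sub A⊆K))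

  module G'DC = DoubleCosets G'-sub

  E∖G' : ∀ {x} → x ∈ E → x ∉ G' → ∃ λ r → r ∈ R₂ × x ∈ DoubleCoset G H r H
  E∖G' x∈ x∉G' with E⁻ x∈
  ... | inj₁ x∈H = ⊥-elim (x∉G' (H⊆G' x∈H))
  ... | inj₂ (s , s∈S , x∈DC) with S⁻ s∈S
  ...   | inj₁ s∈R₁ = ⊥-elim (x∉G' (DC-⊆-subgroup G'-sub H⊆G' x∈DC (R₁⊆G' s∈R₁)))
  ...   | inj₂ s∈R₂ = s , s∈R₂ , x∈DC

  DC⊆E∖G' : ∀ {r} → r ∈ R₂ → DoubleCoset G H r H ⊆ E ∩ ∁ G'
  DC⊆E∖G' {r} r∈ x∈ = ∩∁⁺ (DC⊆E (R₂⊆S r∈) x∈)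
    (λ x∈G' → R₂∉G' r r∈ (DC-⊆-subgroup G'-sub H⊆G' (DC-sym x∈) x∈G'))

  ∈G'DC : ∀ {r x} → x ∈ DoubleCoset G H r H → x ∈ DoubleCoset G G' r G'
  ∈G'DC x∈ with DC⁻ x∈
  ... | a , b , a∈ , b∈ , eq = G'DC.DC⁺ (H⊆G' a∈) (H⊆G' b∈) eq

  ∪⊆ : ∀ {A B K : Sub G} → A ⊆ K → B ⊆ K → A ∪ B ⊆ K
  ∪⊆ {A} {B} A⊆K B⊆K x∈ with x∈p∪q⁻ A B x∈
  ... | inj₁ x∈A = A⊆K x∈A
  ... | inj₂ x∈B = B⊆K x∈B

  -- Let x lie in HrH and axb in HsH, with r, s in R₂. Then G'rG' = G'sG', so the groups generated
  -- by `H` with r and by `H` with s agree. The first lies in `K`, hence so do s and axb.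
  double-coset : ∀ {K} → IsSubgroup G K → H ⊆ K → ∀ {x a b} → x ∈ E → x ∉ G' → a ∈ G' → b ∈ G' →
    ((a ∙ x) ∙ b) ∈ E → x ∈ K → ((a ∙ x) ∙ b) ∈ K
  double-coset {K} K-sub H⊆K {x} {a} {b} x∈E x∉G' a∈ b∈ y∈E x∈K
    with E∖G' x∈E x∉G' | E∖G' y∈E (λ y∈G' → x∉G' (Subgroup.∙∈-cancelˡ G'-sub a∈ (Subgroup.∙∈-cancelʳ G'-sub b∈ y∈G')))
  ... | r , r∈R₂ , x∈DC | s , s∈R₂ , y∈DC = DC-⊆-subgroup K-sub H⊆K y∈DC s∈K
    where
    G'rG'≡G'sG' : DoubleCoset G G' r G' ≡ DoubleCoset G G' s G'
    G'rG'≡G'sG' = trans (sym (G'DC.DC-≡ (∈G'DC x∈DC)))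
      (trans (sym (G'DC.DC-≡ (G'DC.DC⁺ a∈ b∈ refl))) (G'DC.DC-≡ (∈G'DC y∈DC)))
    s∈K : s ∈ K
    s∈K = proj₂ (same-gen r s r∈R₂ s∈R₂ G'rG'≡G'sG' s) (λ J _ A⊆J → A⊆J (q⊆p∪q H ⁅ s ⁆ (x∈⁅x⁆ s)))
      K K-sub (∪⊆ H⊆K λ t∈ → subst (_∈ K) (sym (x∈⁅y⁆⇒x≡y r t∈)) (DC-⊆-subgroup K-sub H⊆K (DC-sym x∈DC) x∈K))

  open Connectivity G'-sub H⊆G' R₁⊆S κ' κ'-conn
  open Extension H-sub G'-sub H⊆G' (κ' * ∣ H ∣) (dSum G H R₂ * ∣ H ∣) using (Setting; separator-bound)

  setting : Setting E
  setting = record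
    { H⊆E = H⊆E
    ; left = E-left
    ; right = E-right
    ; G'-generated = λ {K} K-sub H⊆K h x∈ → G'⁻ x∈ K K-sub
        (∪⊆ H⊆K λ r∈ → h (DC⊆E (R₁⊆S r∈) (DC-refl _)) (R₁⊆G' r∈))
    ; G-generated = λ {K} K-sub E⊆K x → generated x K K-sub
        (∪⊆ (λ h∈ → E⊆K (H⊆E h∈)) (λ s∈ → E⊆K (DC⊆E s∈ (DC-refl _))))
    ; double-coset = double-coset
    ; conn⁺ = conn⁺
    ; conn⁻ = conn⁻
    ; d≤ = dSum-bound H-sub (λ s t s∈ t∈ → distinct s t (R₂⊆S s∈) (R₂⊆S t∈)) (E ∩ ∁ G') DC⊆E∖G'
    }

  bound : ∣G'∣ ⊓ (κ' * ∣ H ∣ + dSum G H R₂ * ∣ H ∣) ≤ κ * ∣ H ∣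
  bound = ≤-trans (separator-≥ ¬sc λ A → separator-bound A X setting) (≤-reflexive (sym κ≡∣X∣))

  -- The quotient |G'|/|H| is a natural-number division, so the two values of the minimum are
  -- treated apart: the first by monotonicity of division, the second by cancelling |H|.
  conclude : ∣G'∣ ⊓ (κ' * ∣ H ∣ + dSum G H R₂ * ∣ H ∣) ≡ ∣G'∣
           ⊎ ∣G'∣ ⊓ (κ' * ∣ H ∣ + dSum G H R₂ * ∣ H ∣) ≡ κ' * ∣ H ∣ + dSum G H R₂ * ∣ H ∣ →
    (∣ G' ∣ / ∣ H ∣) ⊓ (κ' + dSum G H R₂) ≤ κ
  conclude (inj₁ ≡∣G'∣) = ≤-trans (m⊓n≤m (∣ G' ∣ / ∣ H ∣) _) (≤-trans
    (/-monoˡ-≤ ∣ H ∣ (subst (_≤ κ * ∣ H ∣) ≡∣G'∣ bound)) (≤-reflexive (m*n/n≡m κ ∣ H ∣)))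
  conclude (inj₂ ≡sum) = ≤-trans (m⊓n≤n (∣ G' ∣ / ∣ H ∣) _) (*-cancelʳ-≤ _ κ (∣ H ∣)
    (subst (_≤ κ * ∣ H ∣) (trans ≡sum (sym (*-distribʳ-+ (∣ H ∣) κ' (dSum G H R₂)))) bound))
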